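{- Let $k,n$ be positive integers with $n\ge 2k+1$. Then the boxicity of the Kneser graph $Kn(k,n)$ satisfies $\mathrm{box}(Kn(k,n))\le n-2$. Moreover, if $k\ge 2$ and $n\ge 2k^3-2k^2+1$, then $$\mathrm{box}(Kn(k,n))\ \ge\ n-\frac{13k^2-11k+16}{2}.$$
   Context: An axis-parallel $d$-dimensional box is a cartesian product $I_1\times I_2\times\dots\times I_d$ where each $I_i$ is a closed sub-interval of the real line (the whole line $\mathbb R$ is allowed). For a finite graph $G=(V,E)$, the boxicity $\mathrm{box}(G)$ is the minimum dimension $d\geq 0$ such that $G$ is the intersection graph of a family $(B_v)_{v\in V}$ of $d$-dimensional axis-parallel boxes in $\mathbb R^d$, i.e. distinct $u,v\in V$ are adjacent if and only if $B_u\cap B_v\ne\varnothing$ (a complete graph has boxicity $0$). For positive integers $k,n$ with $n\ge 2k+1$, the Kneser graph $Kn(k,n)$ has as vertices all $k$-element subsets of $[n]=\{1,\dots,n\}$, two vertices being adjacent if the corresponding $k$-sets are disjoint. -}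

module Defs where

open import Level using (0ℓ)
open import Data.Empty using (⊥)
open import Data.Fin.Base using (Fin; zero; suc; toℕ; fromℕ<; splitAt; _↑ˡ_; _↑ʳ_; combine; remQuot; finToFun; funToFin)
open import Data.Fin.Properties using (any?; all?; toℕ-fromℕ<; splitAt-↑ˡ; splitAt-↑ʳ; remQuot-combine; finToFun-funToFin)
open import Data.Fin.Subset using (Subset; inside; outside; _∩_; Empty; ∣_∣)
  renaming (_∈_ to _∈ₛ_)
open import Data.Fin.Subset.Properties using (p⊆q⇒∣p∣≤∣q∣; p⊂q⇒∣p∣<∣q∣; ∣p∣≤n; ∩-comm; ∩-idem; Empty-unique; ∣⊥∣≡0; nonempty?)
open import Data.Integer.Base as ℤ using (+_)
import Data.Integer.Properties as ℤ
open import Data.List.Base using (List; []; _∷_; _++_; map; length; lookup; concatMap; [_])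
open import Data.List.Membership.Propositional using (_∈_)
open import Data.List.Membership.Propositional.Properties using (∈-++⁺ˡ; ∈-++⁺ʳ; ∈-map⁺; ∈-concatMap⁺)
open import Data.List.Relation.Unary.Any as Any using (here)
import Data.List.Relation.Unary.Any.Properties as Any
open import Data.Nat.Base as ℕ using (ℕ; zero; suc; z≤n; s≤s; NonZero)
import Data.Nat.Properties as ℕ
open import Data.Nat.Coprimality using (1-coprimeTo) renaming (sym to coprime-sym)
open import Data.Product using (∃; _×_; _,_; proj₁; proj₂)
open import Data.Product.Properties using (≡-dec)
open import Data.Rational.Base as ℚ using (ℚ; mkℚ; *≤*; 0ℚ; 1ℚ)
import Data.Rational.Properties as ℚ
open import Data.Sum.Base using (_⊎_; inj₁; inj₂; [_,_]′)
open import Data.Unit.Base using (⊤; tt)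
import Data.Bool.Properties as Bool
open import Data.Vec.Base using ([]; _∷_; tabulate)
open import Data.Vec.Properties using ([]=⇒lookup; lookup⇒[]=; lookup∘tabulate)
  renaming (≡-dec to vec-≡-dec)
open import Function.Base using (_∘_; id)
open import Function.Bundles using (_⇔_; mk⇔; Equivalence)
open import Relation.Binary.Core using (Rel)
open import Relation.Binary.Definitions using (Decidable; DecidableEquality; Symmetric)
open import Relation.Binary.PropositionalEquality using (_≡_; _≢_; _≗_; refl; sym; trans; cong; subst)
open import Relation.Nullary using (¬_; Dec; yes; no; contradiction; does)
open import Relation.Nullary.Decidable using (¬?; map′; _×-dec_; _→-dec_; decidable-stable; ¬¬-excluded-middle; dec-true; dec-false)
open import Relation.Unary using (Pred)

open Equivalence using (to; from)

-- Real numbers are two-sided Dedekind cuts of ℚ.  Only their order is used,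
-- and x and y represent the same real number when x ≤ℝ y and y ≤ℝ x.
record ℝ : Set₁ where
  field
    L U      : Pred ℚ 0ℓ
    L-inhab  : ∃ L
    U-inhab  : ∃ U
    L-round  : ∀ q → L q ⇔ (∃ λ r → q ℚ.< r × L r)
    U-round  : ∀ q → U q ⇔ (∃ λ r → r ℚ.< q × U r)
    disjoint : ∀ q → ¬ (L q × U q)
    located  : ∀ {q r} → q ℚ.< r → L q ⊎ U r

infix 4 _≤ℝ_

_≤ℝ_ : ℝ → ℝ → Set
x ≤ℝ y = ∀ q → ℝ.L x q → ℝ.L y q

-- The nonempty closed intervals of the real line, bounded or not.
data Interval : Set₁ where
  [_,_]⟨_⟩ : (a b : ℝ) → a ≤ℝ b → Interval
  [_,∞⟩    : ℝ → Interval
  ⟨-∞,_]   : ℝ → Interval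
  ⟨-∞,∞⟩   : Interval

_∈ᴵ_ : ℝ → Interval → Set
x ∈ᴵ [ a , b ]⟨ _ ⟩ = a ≤ℝ x × x ≤ℝ b
x ∈ᴵ [ a ,∞⟩        = a ≤ℝ x
x ∈ᴵ ⟨-∞, b ]       = x ≤ℝ b
x ∈ᴵ ⟨-∞,∞⟩         = ⊤

Box : ℕ → Set₁
Box d = Fin d → Interval

_∈ᴮ_ : ∀ {d} → (Fin d → ℝ) → Box d → Set
x ∈ᴮ B = ∀ i → x i ∈ᴵ B i

Meet : ∀ {d} → Box d → Box d → Set₁
Meet B C = ∃ λ x → x ∈ᴮ B × x ∈ᴮ C

-- The list of vertices may contain repetitions.
record FiniteGraph : Set₁ where
  field
    Vertex   : Set
    _≟_      : DecidableEquality Vertex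
    vertices : List Vertex
    complete : ∀ v → v ∈ vertices
    Adj      : Rel Vertex 0ℓ
    adj?     : Decidable Adj
    symm     : Symmetric Adj
    irrefl   : ∀ v → ¬ Adj v v

IsBoxRep : (G : FiniteGraph) (d : ℕ) → (FiniteGraph.Vertex G → Box d) → Set₁
IsBoxRep G d B = ∀ u v → u ≢ v → Adj u v ⇔ Meet (B u) (B v)
  where open FiniteGraph G

BoxRep : FiniteGraph → ℕ → Set₁
BoxRep G d = ∃ (IsBoxRep G d)

IsBoxicity : FiniteGraph → ℕ → Set₁
IsBoxicity G b = BoxRep G b × (∀ d → BoxRep G d → b ℕ.≤ d)

------------------------------------------------------------------------
-- Existence of the minimum.  A representation by real boxes can be replaced,
-- up to double negation, by one whose endpoints are ranks below a fixed bound;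
-- whether the latter exists can be decided by exhaustive search.

module Existence where

  -- Order properties of ℝ

  ≤ℝ-refl : ∀ x → x ≤ℝ x
  ≤ℝ-refl x q = id

  ≤ℝ-trans : ∀ {x y z} → x ≤ℝ y → y ≤ℝ z → x ≤ℝ z
  ≤ℝ-trans x≤y y≤z q = y≤z q ∘ x≤y q

  ≰ℝ⇒≥ : ∀ x y → ¬ (x ≤ℝ y) → y ≤ℝ x
  ≰ℝ⇒≥ x y x≰y q q∈y with to (ℝ.L-round y q) q∈y
  ... | r , q<r , r∈y with ℝ.located x q<r
  ...   | inj₁ q∈x  = q∈x
  ...   | inj₂ r∈Ux = contradiction x≤y x≰y
    where
    x≤y : x ≤ℝ y
    x≤y s s∈x with s ℚ.<? r
    ... | yes s<r = from (ℝ.L-round y s) (r , s<r , r∈y)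
    ... | no  s≮r with r ℚ.≟ s
    ...   | yes refl = contradiction (s∈x , r∈Ux) (ℝ.disjoint x s)
    ...   | no  r≢s  = contradiction
      (from (ℝ.L-round x r) (s , ℚ.≰⇒> (λ s≤r → r≢s (ℚ.≤-antisym (ℚ.≮⇒≥ s≮r) s≤r)) , s∈x) , r∈Ux)
      (ℝ.disjoint x r)

  fromℚ : ℚ → ℝ
  fromℚ p = record
    { L        = ℚ._< p
    ; U        = p ℚ.<_
    ; L-inhab  = p ℚ.- 1ℚ , subst (p ℚ.- 1ℚ ℚ.<_) (ℚ.+-identityʳ p) (ℚ.+-monoʳ-< p (ℚ.negative⁻¹ (ℚ.- 1ℚ)))
    ; U-inhab  = p ℚ.+ 1ℚ , subst (ℚ._< p ℚ.+ 1ℚ) (ℚ.+-identityʳ p) (ℚ.+-monoʳ-< p (ℚ.positive⁻¹ 1ℚ))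
    ; L-round  = λ q → mk⇔ ℚ.<-dense (λ (r , q<r , r<p) → ℚ.<-trans q<r r<p)
    ; U-round  = λ q → mk⇔ (λ p<q → let r , p<r , r<q = ℚ.<-dense p<q in r , r<q , p<r)
                            (λ (r , r<q , p<r) → ℚ.<-trans p<r r<q)
    ; disjoint = λ q (q<p , p<q) → ℚ.<-irrefl refl (ℚ.<-trans q<p p<q)
    ; located  = loc
    }
    where
    loc : ∀ {q r} → q ℚ.< r → q ℚ.< p ⊎ p ℚ.< r
    loc {q} q<r with q ℚ.<? p
    ... | yes q<p = inj₁ q<p
    ... | no  q≮p = inj₂ (ℚ.≤-<-trans (ℚ.≮⇒≥ q≮p) q<r)

  fromℕ : ℕ → ℝ
  fromℕ n = fromℚ (mkℚ (+ n) 0 (coprime-sym (1-coprimeTo n)))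

  fromℕ-mono : ∀ {m n} → m ℕ.≤ n → fromℕ m ≤ℝ fromℕ n
  fromℕ-mono m≤n q q<m = ℚ.<-≤-trans q<m (*≤* (ℤ.*-monoʳ-≤-nonNeg (+ 1) (ℤ.+≤+ m≤n)))

  fromℕ-cancel : ∀ {m n} → fromℕ m ≤ℝ fromℕ n → m ℕ.≤ n
  fromℕ-cancel {m} {n} m≤n with m ℕ.≤? n
  ... | yes m≤n′ = m≤n′
  ... | no  m≰n  =
    contradiction (m≤n _ (ℚ.*<* (ℤ.*-monoʳ-<-pos (+ 1) (ℤ.+<+ (ℕ.≰⇒> m≰n))))) (ℚ.<-irrefl refl)

  -- Endpoints of intervals, possibly infinite

  data Ext : Set₁ where
    -∞ +∞ : Ext
    fin   : ℝ → Ext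

  _≤ᴱ_ : Ext → Ext → Set
  -∞    ≤ᴱ _     = ⊤
  fin _ ≤ᴱ -∞    = ⊥
  fin x ≤ᴱ fin y = x ≤ℝ y
  fin _ ≤ᴱ +∞    = ⊤
  +∞    ≤ᴱ -∞    = ⊥
  +∞    ≤ᴱ fin _ = ⊥
  +∞    ≤ᴱ +∞    = ⊤

  ≤ᴱ-trans : ∀ x y z → x ≤ᴱ y → y ≤ᴱ z → x ≤ᴱ z
  ≤ᴱ-trans -∞      _       _       _ _ = tt
  ≤ᴱ-trans (fin x) (fin y) (fin z) p q = ≤ℝ-trans {x} {y} {z} p q
  ≤ᴱ-trans (fin _) (fin _) +∞      _ _ = tt
  ≤ᴱ-trans (fin _) +∞      +∞      _ _ = tt
  ≤ᴱ-trans +∞      +∞      +∞      _ _ = tt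

  ≰ᴱ⇒≥ : ∀ x y → ¬ (x ≤ᴱ y) → y ≤ᴱ x
  ≰ᴱ⇒≥ -∞      _       n = contradiction tt n
  ≰ᴱ⇒≥ (fin _) -∞      n = tt
  ≰ᴱ⇒≥ (fin x) (fin y) n = ≰ℝ⇒≥ x y n
  ≰ᴱ⇒≥ (fin _) +∞      n = contradiction tt n
  ≰ᴱ⇒≥ +∞      -∞      n = tt
  ≰ᴱ⇒≥ +∞      (fin _) n = tt
  ≰ᴱ⇒≥ +∞      +∞      n = tt

  lo hi : Interval → Ext
  lo [ a , _ ]⟨ _ ⟩ = fin a
  lo [ a ,∞⟩        = fin a
  lo ⟨-∞, _ ]       = -∞
  lo ⟨-∞,∞⟩         = -∞
  hi [ _ , b ]⟨ _ ⟩ = fin b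
  hi [ _ ,∞⟩        = +∞
  hi ⟨-∞, b ]       = fin b
  hi ⟨-∞,∞⟩         = +∞

  lo≤hi : ∀ I → lo I ≤ᴱ hi I
  lo≤hi [ _ , _ ]⟨ p ⟩ = p
  lo≤hi [ _ ,∞⟩        = tt
  lo≤hi ⟨-∞, _ ]       = tt
  lo≤hi ⟨-∞,∞⟩         = tt

  ∈ᴵ⇒ : ∀ x I → x ∈ᴵ I → lo I ≤ᴱ fin x × fin x ≤ᴱ hi I
  ∈ᴵ⇒ x [ _ , _ ]⟨ _ ⟩ p = p
  ∈ᴵ⇒ x [ _ ,∞⟩        p = p , tt
  ∈ᴵ⇒ x ⟨-∞, _ ]       p = tt , p
  ∈ᴵ⇒ x ⟨-∞,∞⟩         p = tt , tt

  ∈ᴵ⇐ : ∀ x I → lo I ≤ᴱ fin x → fin x ≤ᴱ hi I → x ∈ᴵ I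
  ∈ᴵ⇐ x [ _ , _ ]⟨ _ ⟩ p q = p , q
  ∈ᴵ⇐ x [ _ ,∞⟩        p q = p
  ∈ᴵ⇐ x ⟨-∞, _ ]       p q = q
  ∈ᴵ⇐ x ⟨-∞,∞⟩         p q = tt

  between : ∀ I J → lo I ≤ᴱ hi J → ∃ λ x → lo I ≤ᴱ fin x × fin x ≤ᴱ hi J
  between [ a , _ ]⟨ _ ⟩ J p = a , ≤ℝ-refl a , p
  between [ a ,∞⟩        J p = a , ≤ℝ-refl a , p
  between ⟨-∞, _ ]       [ _ , b ]⟨ _ ⟩ p = b , tt , ≤ℝ-refl b
  between ⟨-∞, _ ]       [ _ ,∞⟩        p = fromℚ 0ℚ , tt , tt
  between ⟨-∞, _ ]       ⟨-∞, b ]       p = b , tt , ≤ℝ-refl b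
  between ⟨-∞, _ ]       ⟨-∞,∞⟩         p = fromℚ 0ℚ , tt , tt
  between ⟨-∞,∞⟩         [ _ , b ]⟨ _ ⟩ p = b , tt , ≤ℝ-refl b
  between ⟨-∞,∞⟩         [ _ ,∞⟩        p = fromℚ 0ℚ , tt , tt
  between ⟨-∞,∞⟩         ⟨-∞, b ]       p = b , tt , ≤ℝ-refl b
  between ⟨-∞,∞⟩         ⟨-∞,∞⟩         p = fromℚ 0ℚ , tt , tt

  common : ∀ I J → Dec (lo I ≤ᴱ lo J) → Dec (hi I ≤ᴱ hi J) →
           lo I ≤ᴱ hi J → lo J ≤ᴱ hi I → ∃ λ x → x ∈ᴵ I × x ∈ᴵ J
  common I J dl dh p q = x , ∈ᴵ⇐ x I lI hI , ∈ᴵ⇐ x J lJ hJ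
    where
    glue : ∀ A B → lo I ≤ᴱ lo A → lo J ≤ᴱ lo A → hi B ≤ᴱ hi I → hi B ≤ᴱ hi J → lo A ≤ᴱ hi B →
           ∃ λ x → (lo I ≤ᴱ fin x × fin x ≤ᴱ hi I) × (lo J ≤ᴱ fin x × fin x ≤ᴱ hi J)
    glue A B a b c d e with between A B e
    ... | x , l , h =
      x , (≤ᴱ-trans (lo I) (lo A) (fin x) a l , ≤ᴱ-trans (fin x) (hi B) (hi I) h c)
        , (≤ᴱ-trans (lo J) (lo A) (fin x) b l , ≤ᴱ-trans (fin x) (hi B) (hi J) h d)

    reflᴱ : ∀ e → e ≤ᴱ e
    reflᴱ -∞      = tt
    reflᴱ +∞      = tt
    reflᴱ (fin x) = ≤ℝ-refl x

    found : Dec (lo I ≤ᴱ lo J) → Dec (hi I ≤ᴱ hi J) →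
            ∃ λ x → (lo I ≤ᴱ fin x × fin x ≤ᴱ hi I) × (lo J ≤ᴱ fin x × fin x ≤ᴱ hi J)
    found (yes l) (yes h) = glue J I l (reflᴱ (lo J)) (reflᴱ (hi I)) h q
    found (yes l) (no  h) = glue J J l (reflᴱ (lo J)) (≰ᴱ⇒≥ (hi I) (hi J) h) (reflᴱ (hi J)) (lo≤hi J)
    found (no  l) (yes h) = glue I I (reflᴱ (lo I)) (≰ᴱ⇒≥ (lo I) (lo J) l) (reflᴱ (hi I)) h (lo≤hi I)
    found (no  l) (no  h) = glue I J (reflᴱ (lo I)) (≰ᴱ⇒≥ (lo I) (lo J) l) (≰ᴱ⇒≥ (hi I) (hi J) h) (reflᴱ (hi J)) p

    r  = found dl dh
    x  = proj₁ r
    lI = proj₁ (proj₁ (proj₂ r))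
    hI = proj₂ (proj₁ (proj₂ r))
    lJ = proj₁ (proj₂ (proj₂ r))
    hJ = proj₂ (proj₂ (proj₂ r))

  -- Finite choice and finite search

  ¬¬-Fin : ∀ {a n} {P : Fin n → Set a} → (∀ i → ¬ ¬ P i) → ¬ ¬ (∀ i → P i)
  ¬¬-Fin {n = zero}  f k = k λ ()
  ¬¬-Fin {n = suc n} f k =
    f zero λ p → ¬¬-Fin (f ∘ suc) λ ps → k λ { zero → p ; (suc i) → ps i }

  anyFun? : ∀ {m n p} {P : (Fin n → Fin m) → Set p} →
            (∀ {f g} → f ≗ g → P f → P g) → (∀ f → Dec (P f)) → Dec (∃ P)
  anyFun? resp P? = map′ (λ (c , p) → finToFun c , p)
                         (λ (f , p) → funToFin f , resp (sym ∘ finToFun-funToFin f) p)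
                         (any? (P? ∘ finToFun))

  ranking : ∀ {M} (_≼_ : Fin M → Fin M → Set) → (∀ i j → Dec (i ≼ j)) →
            (∀ {i j k} → i ≼ j → j ≼ k → i ≼ k) → (∀ {i j} → ¬ (i ≼ j) → j ≼ i) →
            ∃ λ (r : Fin M → Fin (suc M)) → ∀ i j → i ≼ j ⇔ toℕ (r i) ℕ.≤ toℕ (r j)
  ranking {M} _≼_ ≼? ≼-trans ⋠⇒≽ = r , λ i j → mk⇔ (mono i j) (cancel i j)
    where
    below : Fin M → Subset M
    below j = tabulate λ m → does (¬? (≼? j m))

    ∈-below : ∀ {j m} → ¬ (j ≼ m) → m ∈ₛ below j
    ∈-below {j} {m} j⋠m = lookup⇒[]= m (below j)
      (trans (lookup∘tabulate _ m) (dec-true (¬? (≼? j m)) j⋠m))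

    below-∈ : ∀ {j m} → m ∈ₛ below j → ¬ (j ≼ m)
    below-∈ {j} {m} m∈ j≼m with
      trans (sym ([]=⇒lookup m∈)) (trans (lookup∘tabulate _ m) (dec-false (¬? (≼? j m)) (λ n → n j≼m)))
    ... | ()

    r : Fin M → Fin (suc M)
    r j = fromℕ< (s≤s (∣p∣≤n (below j)))

    r-≡ : ∀ j → toℕ (r j) ≡ ∣ below j ∣
    r-≡ j = toℕ-fromℕ< (s≤s (∣p∣≤n (below j)))

    incl : ∀ {i j} → i ≼ j → ∀ {m} → m ∈ₛ below i → m ∈ₛ below j
    incl i≼j m∈ = ∈-below (below-∈ m∈ ∘ ≼-trans i≼j)

    mono : ∀ i j → i ≼ j → toℕ (r i) ℕ.≤ toℕ (r j)
    mono i j i≼j rewrite r-≡ i | r-≡ j = p⊆q⇒∣p∣≤∣q∣ (incl i≼j)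

    ≼-refl : ∀ j → j ≼ j
    ≼-refl j with ≼? j j
    ... | yes p = p
    ... | no  n = ⋠⇒≽ n

    cancel : ∀ i j → toℕ (r i) ℕ.≤ toℕ (r j) → i ≼ j
    cancel i j ri≤rj with ≼? i j
    ... | yes p = p
    ... | no  n rewrite r-≡ i | r-≡ j = contradiction ri≤rj (ℕ.<⇒≱
      (p⊂q⇒∣p∣<∣q∣ (incl (⋠⇒≽ n) , j , ∈-below n , λ j∈ → below-∈ j∈ (≼-refl j))))

  module _ (G : FiniteGraph) where
    open FiniteGraph G

    N M : ℕ
    N = length vertices
    M = N ℕ.+ N

    vertex : Fin N → Vertex
    vertex = lookup vertices

    index : Vertex → Fin N
    index v = Any.index (complete v)

    vertex-index : ∀ v → vertex (index v) ≡ v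
    vertex-index v = sym (Any.lookup-index (complete v))

    record IsNatRep {d} (l h : Fin d → Fin N → ℕ) : Set where
      constructor natRep
      field
        l≤h : ∀ i p → l i p ℕ.≤ h i p
        rep : ∀ p q → vertex p ≢ vertex q →
              (Adj (vertex p) (vertex q) → ∀ i → l i p ℕ.≤ h i q × l i q ℕ.≤ h i p) ×
              ((∀ i → l i p ℕ.≤ h i q × l i q ℕ.≤ h i p) → Adj (vertex p) (vertex q))

    isNatRep? : ∀ {d} (l h : Fin d → Fin N → ℕ) → Dec (IsNatRep l h)
    isNatRep? l h = map′ (λ (a , b) → natRep a b) (λ (natRep a b) → a , b)
      ((all? λ i → all? λ p → l i p ℕ.≤? h i p) ×-dec
       (all? λ p → all? λ q → ¬? (vertex p ≟ vertex q) →-dec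
         ((adj? _ _ →-dec meet? p q) ×-dec (meet? p q →-dec adj? _ _))))
      where
      meet? : ∀ p q → Dec (∀ i → l i p ℕ.≤ h i q × l i q ℕ.≤ h i p)
      meet? p q = all? λ i → (l i p ℕ.≤? h i q) ×-dec (l i q ℕ.≤? h i p)

    isNatRep-resp : ∀ {d} {l h l′ h′ : Fin d → Fin N → ℕ} →
                    (∀ i p → l i p ≡ l′ i p) → (∀ i p → h i p ≡ h′ i p) →
                    IsNatRep l h → IsNatRep l′ h′
    isNatRep-resp {l = l} {h} {l′} {h′} l≡ h≡ (natRep a b) = natRep
      (λ i p → fwd i p p (a i p))
      (λ p q p≢q → (λ pq i → let x , y = proj₁ (b p q p≢q) pq i in fwd i p q x , fwd i q p y)
                 , (λ f → proj₂ (b p q p≢q) λ i → let x , y = f i in bwd i p q x , bwd i q p y))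
      where
      fwd : ∀ i p q → l i p ℕ.≤ h i q → l′ i p ℕ.≤ h′ i q
      fwd i p q x rewrite l≡ i p | h≡ i q = x
      bwd : ∀ i p q → l′ i p ℕ.≤ h′ i q → l i p ℕ.≤ h i q
      bwd i p q x rewrite l≡ i p | h≡ i q = x

    low high : ∀ {d} → (Fin (d ℕ.* M) → Fin (suc M)) → Fin d → Fin N → ℕ
    low  g i p = toℕ (g (combine i (p ↑ˡ N)))
    high g i p = toℕ (g (combine i (N ↑ʳ p)))

    RankRep : ℕ → Set
    RankRep d = ∃ λ (g : Fin (d ℕ.* M) → Fin (suc M)) → IsNatRep {d} (low g) (high g)

    rankRep? : ∀ d → Dec (RankRep d)
    rankRep? d = anyFun?
      (λ {f} {g} f≗g → isNatRep-resp {l = low f} {high f} {low g} {high g}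
         (λ i p → cong toℕ (f≗g _)) (λ i p → cong toℕ (f≗g _)))
      (λ g → isNatRep? (low g) (high g))

    natRep⇒boxRep : ∀ {d} {l h : Fin d → Fin N → ℕ} → IsNatRep l h → BoxRep G d
    natRep⇒boxRep {d} {l} {h} (natRep a b) = B , λ u v u≢v →
      let p≢q : vertex (index u) ≢ vertex (index v)
          p≢q e = u≢v (trans (sym (vertex-index u)) (trans e (vertex-index v)))
          f , g = b (index u) (index v) p≢q
      in mk⇔
        (λ uv →
          let w = f (subst (λ z → Adj (vertex (index u)) z) (sym (vertex-index v))
                       (subst (λ z → Adj z v) (sym (vertex-index u)) uv))
          in (λ i → fromℕ (l i (index u) ℕ.⊔ l i (index v)))
           , (λ i → fromℕ-mono (ℕ.m≤m⊔n _ _) , fromℕ-mono (ℕ.⊔-lub (a i (index u)) (proj₂ (w i))))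
           , (λ i → fromℕ-mono (ℕ.m≤n⊔m (l i (index u)) _) , fromℕ-mono (ℕ.⊔-lub (proj₁ (w i)) (a i (index v)))))
        (λ (x , x∈u , x∈v) →
          subst (λ z → Adj z v) (vertex-index u)
            (subst (λ z → Adj (vertex (index u)) z) (vertex-index v)
              (g λ i → fromℕ-cancel (λ q → proj₂ (x∈v i) q ∘ proj₁ (x∈u i) q)
                     , fromℕ-cancel (λ q → proj₂ (x∈u i) q ∘ proj₁ (x∈v i) q))))
      where
      B : Vertex → Box d
      B v i = [ fromℕ (l i (index v)) , fromℕ (h i (index v)) ]⟨ fromℕ-mono (a i (index v)) ⟩

    boxRep⇒rankRep : ∀ {d} → BoxRep G d → ¬ ¬ RankRep d
    boxRep⇒rankRep {d} (B , isRep) k =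
      ¬¬-Fin (λ i → ¬¬-Fin λ s → ¬¬-Fin λ t → ¬¬-excluded-middle {A = E i s ≤ᴱ E i t}) (k ∘ build)
      where
      E : Fin d → Fin M → Ext
      E i s = [ (λ p → lo (B (vertex p) i)) , (λ p → hi (B (vertex p) i)) ]′ (splitAt N s)

      build : (∀ i s t → Dec (E i s ≤ᴱ E i t)) → RankRep d
      build E? = g , natRep l≤h (λ p q p≢q → (λ pq → forth p q p≢q pq) , back p q p≢q)
        where
        R : ∀ i → ∃ λ (r : Fin M → Fin (suc M)) → ∀ s t → E i s ≤ᴱ E i t ⇔ toℕ (r s) ℕ.≤ toℕ (r t)
        R i = ranking (λ s t → E i s ≤ᴱ E i t) (E? i)
                (λ {s} {t} {u} → ≤ᴱ-trans (E i s) (E i t) (E i u))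
                (λ {s} {t} → ≰ᴱ⇒≥ (E i s) (E i t))

        g : Fin (d ℕ.* M) → Fin (suc M)
        g c = let i , s = remQuot {d} M c in proj₁ (R i) s

        g-combine : ∀ i s → g (combine i s) ≡ proj₁ (R i) s
        g-combine i s = cong (λ (j , t) → proj₁ (R j) t) (remQuot-combine {d} i s)

        E-lo : ∀ i p → E i (p ↑ˡ N) ≡ lo (B (vertex p) i)
        E-lo i p rewrite splitAt-↑ˡ N p N = refl

        E-hi : ∀ i p → E i (N ↑ʳ p) ≡ hi (B (vertex p) i)
        E-hi i p rewrite splitAt-↑ʳ N N p = refl

        rank : ∀ i p q → lo (B (vertex p) i) ≤ᴱ hi (B (vertex q) i) → low g i p ℕ.≤ high g i q
        rank i p q x
          rewrite g-combine i (p ↑ˡ N) | g-combine i (N ↑ʳ q) | sym (E-lo i p) | sym (E-hi i q)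
          = to (proj₂ (R i) (p ↑ˡ N) (N ↑ʳ q)) x

        unrank : ∀ i p q → low g i p ℕ.≤ high g i q → lo (B (vertex p) i) ≤ᴱ hi (B (vertex q) i)
        unrank i p q x
          rewrite g-combine i (p ↑ˡ N) | g-combine i (N ↑ʳ q) | sym (E-lo i p) | sym (E-hi i q)
          = from (proj₂ (R i) (p ↑ˡ N) (N ↑ʳ q)) x

        l≤h : ∀ i p → low g i p ℕ.≤ high g i p
        l≤h i p = rank i p p (lo≤hi (B (vertex p) i))

        forth : ∀ p q → vertex p ≢ vertex q → Adj (vertex p) (vertex q) →
                ∀ i → low g i p ℕ.≤ high g i q × low g i q ℕ.≤ high g i p
        forth p q p≢q pq i with to (isRep _ _ p≢q) pq
        ... | x , x∈p , x∈q with ∈ᴵ⇒ (x i) _ (x∈p i) | ∈ᴵ⇒ (x i) _ (x∈q i)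
        ...   | lp , hp | lq , hq =
          rank i p q (≤ᴱ-trans _ (fin (x i)) _ lp hq) , rank i q p (≤ᴱ-trans _ (fin (x i)) _ lq hp)

        back : ∀ p q → vertex p ≢ vertex q →
               (∀ i → low g i p ℕ.≤ high g i q × low g i q ℕ.≤ high g i p) → Adj (vertex p) (vertex q)
        back p q p≢q f = from (isRep _ _ p≢q)
          ((λ i → proj₁ (pt i)) , (λ i → proj₁ (proj₂ (pt i))) , (λ i → proj₂ (proj₂ (pt i))))
          where
          lo? : ∀ i → Dec (lo (B (vertex p) i) ≤ᴱ lo (B (vertex q) i))
          lo? i rewrite sym (E-lo i p) | sym (E-lo i q) = E? i (p ↑ˡ N) (q ↑ˡ N)
          hi? : ∀ i → Dec (hi (B (vertex p) i) ≤ᴱ hi (B (vertex q) i))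
          hi? i rewrite sym (E-hi i p) | sym (E-hi i q) = E? i (N ↑ʳ p) (N ↑ʳ q)
          pt : ∀ i → ∃ λ x → x ∈ᴵ B (vertex p) i × x ∈ᴵ B (vertex q) i
          pt i = common (B (vertex p) i) (B (vertex q) i) (lo? i) (hi? i)
                   (unrank i p q (proj₁ (f i))) (unrank i q p (proj₂ (f i)))

    boxRep? : ∀ d → Dec (BoxRep G d)
    boxRep? d with rankRep? d
    ... | yes (_ , r) = yes (natRep⇒boxRep r)
    ... | no  ¬r      = no λ b → boxRep⇒rankRep b ¬r

    -- One dimension per vertex w: w ↦ [0,0], neighbours of w ↦ [0,1], the rest ↦ [1,1].
    someBoxRep : BoxRep G N
    someBoxRep = natRep⇒boxRep {l = l} {h} 
      (natRep l≤h λ p q p≢q →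
         (λ pq i → forth i p q p≢q pq , forth i q p (p≢q ∘ sym) (symm pq))
         , back p q p≢q)
      where
      l h : Fin N → Fin N → ℕ
      l i p with vertex i ≟ vertex p | adj? (vertex i) (vertex p)
      ... | yes _ | _     = 0
      ... | no  _ | yes _ = 0
      ... | no  _ | no  _ = 1
      h i p with vertex i ≟ vertex p
      ... | yes _ = 0
      ... | no  _ = 1

      l≤h : ∀ i p → l i p ℕ.≤ h i p
      l≤h i p with vertex i ≟ vertex p | adj? (vertex i) (vertex p)
      ... | yes _ | _     = z≤n
      ... | no  _ | yes _ = z≤n
      ... | no  _ | no  _ = ℕ.≤-refl

      forth : ∀ i p q → vertex p ≢ vertex q → Adj (vertex p) (vertex q) → l i p ℕ.≤ h i q
      forth i p q p≢q pq with vertex i ≟ vertex p | adj? (vertex i) (vertex p) | vertex i ≟ vertex q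
      ... | yes _ | _     | _     = z≤n
      ... | no  _ | yes _ | _     = z≤n
      ... | no  _ | no  _ | no  _ = ℕ.≤-refl
      ... | no  _ | no  n | yes e = contradiction (subst (λ z → Adj z (vertex p)) (sym e) (symm pq)) n

      back : ∀ p q → vertex p ≢ vertex q →
             (∀ i → l i p ℕ.≤ h i q × l i q ℕ.≤ h i p) → Adj (vertex p) (vertex q)
      back p q p≢q f with vertex p ≟ vertex p | vertex p ≟ vertex q | adj? (vertex p) (vertex q) | proj₂ (f p)
      ... | no  n | _     | _      | _ = contradiction refl n
      ... | yes _ | yes e | _      | _ = contradiction e p≢q
      ... | yes _ | no  _ | yes pq | _ = pq
      ... | yes _ | no  _ | no  _  | ()

  least : ∀ {p} {P : ℕ → Set p} → (∀ n → Dec (P n)) → ∀ n → P n →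
          ∃ λ m → P m × (∀ d → P d → m ℕ.≤ d)
  least P? zero    p = 0 , p , λ _ _ → z≤n
  least P? (suc n) p with P? 0
  ... | yes p₀ = 0 , p₀ , λ _ _ → z≤n
  ... | no ¬p₀ with least (P? ∘ suc) n p
  ...   | m , pm , min = suc m , pm , λ { zero p₀ → contradiction p₀ ¬p₀ ; (suc d) pd → s≤s (min d pd) }

open Existence

abstract
  boxicity : ∀ G → ∃ (IsBoxicity G)
  boxicity G = least (boxRep? G) (length (FiniteGraph.vertices G)) (someBoxRep G)

box : FiniteGraph → ℕ
box G = proj₁ (boxicity G)

box-isBoxicity : ∀ G → IsBoxicity G (box G)
box-isBoxicity G = proj₂ (boxicity G)

------------------------------------------------------------------------
-- Kneser graphs

KSubset : ℕ → ℕ → Set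
KSubset k n = ∃ λ (S : Subset n) → ∣ S ∣ ≡ k

private

  subsets : ∀ n → List (Subset n)
  subsets zero    = [ [] ]
  subsets (suc n) = map (inside ∷_) (subsets n) ++ map (outside ∷_) (subsets n)

  subsets-complete : ∀ {n} (S : Subset n) → S ∈ subsets n
  subsets-complete []            = here refl
  subsets-complete (inside  ∷ S) = ∈-++⁺ˡ (∈-map⁺ (inside ∷_) (subsets-complete S))
  subsets-complete (outside ∷ S) = ∈-++⁺ʳ _ (∈-map⁺ (outside ∷_) (subsets-complete S))

  ofSize : ∀ k {n} → Subset n → List (KSubset k n)
  ofSize k S with ∣ S ∣ ℕ.≟ k
  ... | yes e = [ (S , e) ]
  ... | no  _ = []

  ofSize-complete : ∀ {k n} (S : KSubset k n) → S ∈ ofSize k (proj₁ S)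
  ofSize-complete {k} (S , e) with ∣ S ∣ ℕ.≟ k
  ... | yes e′ = here (cong (S ,_) (ℕ.≡-irrelevant e e′))
  ... | no  ne = contradiction e ne

-- The condition n ≥ 2k+1 plays no role in the construction and is left to statements about Kn k n;
-- k must be nonzero because the empty set is disjoint from itself.
Kn : (k n : ℕ) → .{{NonZero k}} → FiniteGraph
Kn k n = record
  { Vertex   = KSubset k n
  ; _≟_      = ≡-dec (vec-≡-dec Bool._≟_) (λ _ _ → yes (ℕ.≡-irrelevant _ _))
  ; vertices = concatMap (ofSize k) (subsets n)
  ; complete = λ S → ∈-concatMap⁺ (ofSize k) (Any.map (λ { refl → ofSize-complete S }) (subsets-complete (proj₁ S)))
  ; Adj      = λ (S , _) (T , _) → Empty (S ∩ T)
  ; adj?     = λ (S , _) (T , _) → ¬? (nonempty? (S ∩ T))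
  ; symm     = λ {(S , _)} {(T , _)} → subst Empty (∩-comm S T)
  ; irrefl   = λ (S , ∣S∣≡k) e → ℕ.≢-nonZero⁻¹ k
      (trans (sym ∣S∣≡k) (trans (cong ∣_∣ (Empty-unique (subst Empty (∩-idem S) e))) (∣⊥∣≡0 n)))
  }

{-# OPTIONS --safe #-}

-- Write n = n′ + 2 and let 0, 1 be two distinguished elements.  Every other element i gives an
-- interval order: the k-sets containing i become distinct points, those containing 0 to the left
-- and those containing 1 but not 0 to the right, while the other k-sets become intervals around
-- the middle, cut off on the left if they contain 0 and on the right if they contain 1.  Distinct
-- sets meeting in 0 or 1 are then separated by an element of their symmetric difference.
--
-- For the lower bound, choose disjoint (k−1)-sets Q c indexed by four columns c and a further
-- a = n − 4(k−1) elements x, and consider the k-sets {x} ∪ Q c; two of them meet exactly when they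
-- agree in x or in c.  Pair up the columns and call a row x with a pair of columns an item: it has
-- to be separated in some coordinate.  As interval orders contain no 2+2, items of different rows
-- separated in the same coordinate use the same pair of columns, in opposite directions.  Hence no
-- coordinate separates three of the 2a items, and a ≤ d.
module Submission where

open import Defs using (box; Kn; box-isBoxicity; BoxRep; FiniteGraph; KSubset; module Existence)
open import Data.Bool.Base using (Bool; true; false; if_then_else_)
open import Data.Fin.Base using (Fin; zero; suc; toℕ; combine; remQuot; opposite)
open import Data.Fin.Patterns using (0F; 1F; 3F)
open import Data.Fin.Properties as Fin
  using (any?; injective⇒≤; combine-injective; combine-injectiveʳ; combine-remQuot; toℕ-combine;
         toℕ-injective; toℕ<n; ¬∀⟶∃¬)
open import Data.Fin.Subset using (Subset; ⊤; ⊥; _∩_; _∈_; _∉_; Empty; ∣_∣)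
open import Data.Fin.Subset.Properties
  using (_∈?_; ⊆-antisym; p⊂q⇒∣p∣<∣q∣; Empty-unique; ∉⊥; ∣⊥∣≡0; ∣⊤∣≡n; ∩-zeroˡ; ∩-zeroʳ; ∩-idem;
         x∈p∩q⁺; x∈p∩q⁻)
open import Data.Integer.Base as ℤ using (+_)
import Data.Integer.Properties as ℤ
open import Data.Integer.Tactic.RingSolver using (solve-∀)
open import Data.Nat.Base using (ℕ; zero; suc; NonZero; _+_; _*_; _∸_; _^_; _≤_; _<_; _≥_; z≤n; s≤s; ≢-nonZero⁻¹)
open import Data.Nat.Properties as ℕ using (module ≤-Reasoning)
open import Data.Product.Base using (∃; ∃₂; _×_; _,_; proj₁; proj₂; uncurry)
open import Data.Rational.Base as ℚ using (_/_; toℚᵘ)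
import Data.Rational.Properties as ℚ
open import Data.Rational.Unnormalised.Base as ℚᵘ using (mkℚᵘ)
import Data.Rational.Unnormalised.Properties as ℚᵘ
open import Data.Sum.Base using (inj₁; inj₂)
open import Data.Vec.Base using ([]; _∷_; _++_)
open import Data.Vec.Properties using (++-injectiveˡ; ++-injectiveʳ)
open import Function.Base using (_∘_)
open import Function.Definitions using (Injective)
open import Relation.Binary.PropositionalEquality
  using (_≡_; _≢_; refl; sym; trans; cong; cong₂; subst; subst₂)
open import Relation.Nullary using (¬_; Dec; yes; no; does; contradiction)
open import Relation.Nullary.Decidable using (¬?; _×-dec_; decidable-stable)

-- Distinct sets of equal size

∣p∣≡∣q∣∧p≢q⇒p⊈q : ∀ {n} {p q : Subset n} → ∣ p ∣ ≡ ∣ q ∣ → p ≢ q → ∃ λ x → x ∈ p × x ∉ q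
∣p∣≡∣q∣∧p≢q⇒p⊈q {p = p} {q} ∣p∣≡∣q∣ p≢q with any? (λ x → (x ∈? p) ×-dec ¬? (x ∈? q))
... | yes found = found
... | no  none  = contradiction (⊆-antisym p⊆q q⊆p) p≢q
  where
  p⊆q : ∀ {x} → x ∈ p → x ∈ q
  p⊆q {x} x∈p = decidable-stable (x ∈? q) λ x∉q → none (x , x∈p , x∉q)

  -- An element of `q` missing from `p` would make `p` a proper subset of `q`, hence smaller.
  q⊆p : ∀ {x} → x ∈ q → x ∈ p
  q⊆p {x} x∈q = decidable-stable (x ∈? p) λ x∉p →
    ℕ.<-irrefl ∣p∣≡∣q∣ (p⊂q⇒∣p∣<∣q∣ (p⊆q , x , x∈q , x∉p))

-- The upper bound

module StarRepresentation (k n′ : ℕ) .{{_ : NonZero k}} where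

  G : FiniteGraph
  G = Kn k (suc (suc n′))

  open FiniteGraph G using (Adj)
  open Existence using (N; vertex; natRep; natRep⇒boxRep)

  M : ℕ
  M = N G

  set : Fin M → Subset (suc (suc n′))
  set p = proj₁ (vertex G p)

  -- Block 2 stays free of points; its left end separates the sets containing 1 from zone 3.
  zone : Bool → Bool → Fin 4
  zone true  _     = 0F
  zone false true  = 3F
  zone false false = 1F

  -- The points of block 0 lie below `M`, so the interval of a set containing 0 starts just after
  -- them. The defaults 0 and `M * 4` enclose all blocks.
  left : Bool → ℕ
  left true  = M
  left false = 0

  right : Bool → ℕ
  right true  = M * 2
  right false = M * 4

  has₀ has₁ : Fin M → Bool
  has₀ p = does (zero ∈? set p)
  has₁ p = does (suc zero ∈? set p)

  point : Fin M → ℕ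
  point p = toℕ (combine (zone (has₀ p) (has₁ p)) p)

  l h : Fin n′ → Fin M → ℕ
  l i p = if does (suc (suc i) ∈? set p) then point p else left (has₀ p)
  h i p = if does (suc (suc i) ∈? set p) then point p else right (has₁ p)

  point-injective : ∀ {p q} → point p ≡ point q → p ≡ q
  point-injective {p} {q} e =
    combine-injectiveʳ (zone (has₀ p) (has₁ p)) p (zone (has₀ q) (has₁ q)) q (toℕ-injective e)

  point-lower : ∀ p → M * toℕ (zone (has₀ p) (has₁ p)) ≤ point p
  point-lower p rewrite toℕ-combine (zone (has₀ p) (has₁ p)) p = ℕ.m≤m+n _ _

  point-upper : ∀ p → point p < M * suc (toℕ (zone (has₀ p) (has₁ p)))
  point-upper p rewrite toℕ-combine (zone (has₀ p) (has₁ p)) p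
    | ℕ.*-suc M (toℕ (zone (has₀ p) (has₁ p)))
    | ℕ.+-comm M (M * toℕ (zone (has₀ p) (has₁ p))) = ℕ.+-monoʳ-< _ (toℕ<n p)

  left≤right : ∀ b c → left b ≤ right c
  left≤right false _     = z≤n
  left≤right true  true  = ℕ.m≤m*n M 2
  left≤right true  false = ℕ.m≤m*n M 4

  l≤h : ∀ i p → l i p ≤ h i p
  l≤h i p with suc (suc i) ∈? set p
  ... | yes _ = ℕ.≤-refl
  ... | no  _ = left≤right (has₀ p) (has₁ p)

  -- Only a set containing 0 is cut off on the left; a set disjoint from it lacks 0, so its point
  -- avoids block 0.
  left≤point : ∀ {p q} → Adj (vertex G p) (vertex G q) → left (has₀ p) ≤ point q
  left≤point {p} {q} disj with zero ∈? set p | zero ∈? set q | suc zero ∈? set q | point-lower q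
  ... | no  _  | _      | _     | _ = z≤n
  ... | yes xp | yes xq | _     | _ = contradiction (zero , x∈p∩q⁺ (xp , xq)) disj
  ... | yes _  | no  _  | yes _ | le = ℕ.≤-trans (ℕ.m≤m*n M 3) le
  ... | yes _  | no  _  | no  _ | le = ℕ.≤-trans (ℕ.m≤m*n M 1) le

  -- If `q` contains 1, then `p` lacks it and has its point in block 0 or 1, below `M * 2`.
  -- Otherwise the bound is `M * 4`, beyond all points.
  point≤right : ∀ {p q} → Adj (vertex G p) (vertex G q) → point p ≤ right (has₁ q)
  point≤right {p} {q} disj with zero ∈? set p | suc zero ∈? set p | suc zero ∈? set q | point-upper p
  ... | yes _ | _      | yes _  | lt = ℕ.≤-trans (ℕ.<⇒≤ lt) (ℕ.*-monoʳ-≤ M (s≤s z≤n))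
  ... | yes _ | _      | no  _  | lt = ℕ.≤-trans (ℕ.<⇒≤ lt) (ℕ.*-monoʳ-≤ M (s≤s z≤n))
  ... | no  _ | yes xp | yes xq | _  = contradiction (suc zero , x∈p∩q⁺ (xp , xq)) disj
  ... | no  _ | yes _  | no  _  | lt = ℕ.<⇒≤ lt
  ... | no  _ | no  _  | yes _  | lt = ℕ.<⇒≤ lt
  ... | no  _ | no  _  | no  _  | lt = ℕ.≤-trans (ℕ.<⇒≤ lt) (ℕ.*-monoʳ-≤ M (s≤s (s≤s z≤n)))

  adj⇒≤ : ∀ i p q → Adj (vertex G p) (vertex G q) → l i p ≤ h i q
  adj⇒≤ i p q disj with suc (suc i) ∈? set p | suc (suc i) ∈? set q
  ... | yes xp | yes xq = contradiction (_ , x∈p∩q⁺ (xp , xq)) disj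
  ... | yes _  | no  _  = point≤right {p} {q} disj
  ... | no  _  | yes _  = left≤point {p} {q} disj
  ... | no  _  | no  _  = left≤right (has₀ p) (has₁ q)

  Overlap : Fin M → Fin M → Set
  Overlap p q = ∀ i → l i p ≤ h i q × l i q ≤ h i p

  star-separates : ∀ {p q} i → Overlap p q → p ≢ q → suc (suc i) ∈ set p → suc (suc i) ∉ set q
  star-separates {p} {q} i ov p≢q xp xq with suc (suc i) ∈? set p | suc (suc i) ∈? set q | ov i
  ... | yes _  | yes _  | le , ge = p≢q (point-injective (ℕ.≤-antisym le ge))
  ... | no ¬xp | _      | _       = ¬xp xp
  ... | _      | no ¬xq | _       = ¬xq xq

  -- In coordinate `i` the point of `p` lies in block 0, while the interval of `q` starts at `M`.
  zero-separates : ∀ {p q} i → Overlap p q → suc (suc i) ∈ set p → suc (suc i) ∉ set q →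
                   zero ∈ set p → zero ∉ set q
  zero-separates {p} {q} i ov xp x∉q zp zq
    with suc (suc i) ∈? set p | suc (suc i) ∈? set q | zero ∈? set p | zero ∈? set q | ov i | point-upper p
  ... | yes _  | no _   | yes _  | yes _  | _ , ge | lt =
    ℕ.<-irrefl refl (ℕ.≤-<-trans ge (subst (toℕ (combine {4} 0F p) <_) (ℕ.*-identityʳ M) lt))
  ... | no ¬xp | _      | _      | _      | _      | _ = ¬xp xp
  ... | _      | yes xq | _      | _      | _      | _ = x∉q xq
  ... | _      | _      | no ¬zp | _      | _      | _ = ¬zp zp
  ... | _      | _      | _      | no ¬zq | _      | _ = ¬zq zq

  -- In coordinate `i` the point of `p` lies in block 3, while the interval of `q` ends at `M * 2`.
  one-separates : ∀ {p q} i → Overlap p q → suc (suc i) ∈ set p → suc (suc i) ∉ set q →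
                  zero ∉ set p → suc zero ∈ set p → suc zero ∉ set q
  one-separates {p} {q} i ov xp x∉q z∉p op oq
    with suc (suc i) ∈? set p | suc (suc i) ∈? set q | zero ∈? set p | suc zero ∈? set p
       | suc zero ∈? set q | ov i | point-lower p
  ... | yes _  | no _   | no _   | yes _  | yes _  | le , _ | ge =
    -- The index `p` itself witnesses that `M` is positive, whence `M * 2 < M * 3`.
    ℕ.<-irrefl refl (ℕ.<-≤-trans (ℕ.*-monoʳ-< M {{Fin.nonZeroIndex p}} (s≤s (s≤s (s≤s z≤n)))) (ℕ.≤-trans ge le))
  ... | no ¬xp | _      | _      | _      | _      | _      | _ = ¬xp xp
  ... | _      | yes xq | _      | _      | _      | _      | _ = x∉q xq
  ... | _      | _      | yes zp | _      | _      | _      | _ = z∉p zp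
  ... | _      | _      | _      | no ¬op | _      | _      | _ = ¬op op
  ... | _      | _      | _      | _      | no ¬oq | _      | _ = ¬oq oq

  overlap-sym : ∀ {p q} → Overlap p q → Overlap q p
  overlap-sym ov i = proj₂ (ov i) , proj₁ (ov i)

  difference : ∀ {p q} → vertex G p ≢ vertex G q → ∃ λ x → x ∈ set p × x ∉ set q
  difference {p} {q} p≢q = ∣p∣≡∣q∣∧p≢q⇒p⊈q (trans (proj₂ (vertex G p)) (sym (proj₂ (vertex G q))))
    λ e → p≢q (KSubset-≡ e)
    where
    KSubset-≡ : ∀ {S T : KSubset k (suc (suc n′))} → proj₁ S ≡ proj₁ T → S ≡ T
    KSubset-≡ {S , e} {.S , e′} refl = cong (S ,_) (ℕ.≡-irrelevant e e′)

  -- An element of `p` outside `q` may be 1, which has no coordinate of its own. Then an element of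
  -- `q` outside `p` is neither 0 nor 1, and its coordinate separates the two sets.
  zero-disjoint : ∀ {p q} → vertex G p ≢ vertex G q → Overlap p q → zero ∈ set p → zero ∉ set q
  zero-disjoint p≢q ov zp zq with difference p≢q | difference (p≢q ∘ sym)
  ... | zero        , _  , z∉q | _                     = z∉q zq
  ... | suc (suc i) , xp , x∉q | _                     = zero-separates i ov xp x∉q zp zq
  ... | suc zero    , _  , _   | zero        , _  , z∉p = z∉p zp
  ... | suc zero    , op , _   | suc zero    , _  , o∉p = o∉p op
  ... | suc zero    , _  , _   | suc (suc i) , yq , y∉p = zero-separates i (overlap-sym ov) yq y∉p zq zp

  -- An element of `p` outside `q` is not 0, which `p` lacks, nor 1, which `q` contains; so it has a
  -- coordinate.
  one-disjoint-of-no-zero : ∀ {p q} → vertex G p ≢ vertex G q → Overlap p q → zero ∉ set p →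
                            suc zero ∈ set p → suc zero ∉ set q
  one-disjoint-of-no-zero p≢q ov z∉p op oq with difference p≢q
  ... | zero        , zp , _   = z∉p zp
  ... | suc zero    , _  , o∉q = o∉q oq
  ... | suc (suc i) , xp , x∉q = one-separates i ov xp x∉q z∉p op oq

  -- At most one of the two sets contains 0, so one of them can play the part of the set without 0.
  one-disjoint : ∀ {p q} → vertex G p ≢ vertex G q → Overlap p q → Dec (zero ∈ set p) →
                 suc zero ∈ set p → suc zero ∉ set q
  one-disjoint p≢q ov (no  z∉p) op oq = one-disjoint-of-no-zero p≢q ov z∉p op oq
  one-disjoint p≢q ov (yes zp)  op oq =
    one-disjoint-of-no-zero (p≢q ∘ sym) (overlap-sym ov) (zero-disjoint p≢q ov zp) oq op

  overlap⇒adj : ∀ p q → vertex G p ≢ vertex G q → Overlap p q → Adj (vertex G p) (vertex G q)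
  overlap⇒adj p q p≢q ov (x , x∈) = disjointAt x (x∈p∩q⁻ (set p) (set q) x∈)
    where
    disjointAt : ∀ x → ¬ (x ∈ set p × x ∈ set q)
    disjointAt zero          (xp , xq) = zero-disjoint p≢q ov xp xq
    disjointAt (suc zero)    (xp , xq) = one-disjoint p≢q ov (zero ∈? set p) xp xq
    disjointAt (suc (suc i)) (xp , xq) = star-separates i ov (p≢q ∘ cong (vertex G)) xp xq

  boxRep : BoxRep G n′
  boxRep = natRep⇒boxRep G {l = l} {h} (natRep l≤h λ p q p≢q →
    (λ pq i → adj⇒≤ i p q pq , adj⇒≤ i q p (FiniteGraph.symm G {vertex G p} {vertex G q} pq)) , overlap⇒adj p q p≢q)

box-upper : ∀ k n .{{_ : NonZero k}} → 2 ≤ n → box (Kn k n) ≤ n ∸ 2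
box-upper k (suc (suc n′)) _ =
  proj₂ (box-isBoxicity (Kn k (suc (suc n′)))) n′ (StarRepresentation.boxRep k n′)
box-upper k (suc zero) (s≤s ())

-- The lower bound

-- A column is addressed by its pair `e` and its place `o` in that pair. `order` encodes that the
-- two cells of an item are not adjacent, `meet` that cells differing in row and column are.
module ItemCounting {a d : ℕ}
  (l h : Fin d → Fin a → Fin 2 → Fin 2 → ℕ)
  (order : ∀ x e → ∃₂ λ i o → h i x e o < l i x e (opposite o))
  (meet : ∀ i {x y e f o t} → x ≢ y → ¬ (e ≡ f × o ≡ t) → l i x e o ≤ h i y f t)
  where

  coordinate : Fin a → Fin 2 → Fin d
  coordinate x e = proj₁ (order x e)

  direction : Fin a → Fin 2 → Fin 2
  direction x e = proj₁ (proj₂ (order x e))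

  opposite-≢ : (o : Fin 2) → o ≢ opposite o
  opposite-≢ 0F ()
  opposite-≢ 1F ()

  -- The two strict inequalities close up to a cycle as soon as both cross comparisons concern
  -- different columns. That is the case when `e ≢ f`, and also when `o ≡ t`.
  no-2+2 : ∀ {i x y e f o t} → x ≢ y → h i x e o < l i x e (opposite o) → h i y f t < l i y f (opposite t) →
           e ≡ f × o ≢ t
  no-2+2 {i} {x} {y} {e} {f} {o} {t} x≢y lt lt′ = e≡f , λ { refl → clash
    (λ (_ , eq) → opposite-≢ o (sym eq)) (λ (_ , eq) → opposite-≢ o (sym eq)) }
    where
    clash : ¬ (e ≡ f × opposite o ≡ t) → ¬ (f ≡ e × opposite t ≡ o) → _
    clash n₁ n₂ = ℕ.<-irrefl refl (begin-strict
      h i x e o            <⟨ lt ⟩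
      l i x e (opposite o) ≤⟨ meet i x≢y n₁ ⟩
      h i y f t            <⟨ lt′ ⟩
      l i y f (opposite t) ≤⟨ meet i (x≢y ∘ sym) n₂ ⟩
      h i x e o            ∎)
      where open ≤-Reasoning

    e≡f : e ≡ f
    e≡f = decidable-stable (e Fin.≟ f) λ e≢f → clash (e≢f ∘ proj₁) (e≢f ∘ sym ∘ proj₁)

  same-coordinate : ∀ {x y e f} → x ≢ y → coordinate x e ≡ coordinate y f →
                    e ≡ f × direction x e ≢ direction y f
  same-coordinate {x} {y} {e} {f} x≢y eq with order x e | order y f
  same-coordinate x≢y refl | _ , _ , lt | _ , _ , lt′ = no-2+2 x≢y lt lt′

  Doubled : Fin a → Set
  Doubled x = coordinate x 0F ≡ coordinate x 1F

  doubled⇒≡ : ∀ {x} → Doubled x → ∀ e f → coordinate x e ≡ coordinate x f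
  doubled⇒≡ dx 0F 0F = refl
  doubled⇒≡ dx 0F 1F = dx
  doubled⇒≡ dx 1F 0F = sym dx
  doubled⇒≡ dx 1F 1F = refl

  ≡⇒doubled : ∀ {x} e f → e ≢ f → coordinate x e ≡ coordinate x f → Doubled x
  ≡⇒doubled 0F 0F e≢f _  = contradiction refl e≢f
  ≡⇒doubled 0F 1F _   eq = eq
  ≡⇒doubled 1F 0F _   eq = sym eq
  ≡⇒doubled 1F 1F e≢f _  = contradiction refl e≢f

  -- An item of another row in this coordinate would share its pair of columns with both items of
  -- `x`, but these use different pairs.
  doubled-alone : ∀ {x y e f} → Doubled x → coordinate x e ≡ coordinate y f → x ≡ y
  doubled-alone {x} {y} {e} {f} dx eq = decidable-stable (x Fin.≟ y) λ x≢y →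
    let only : ∀ g → g ≡ f
        only g = proj₁ (same-coordinate x≢y (trans (doubled⇒≡ dx g e) eq))
    in contradiction (trans (only 0F) (sym (only 1F))) λ ()

  doubled? : ∀ x → Dec (Doubled x)
  doubled? x = coordinate x 0F Fin.≟ coordinate x 1F

  -- Distinct items of one coordinate get distinct bits: those of one row differ in e, and those of
  -- different rows in their direction.
  bit : Fin a → Fin 2 → Fin 2
  bit x e = if does (doubled? x) then e else direction x e

  -- Items of different rows in one coordinate belong to rows that are not doubled, so their bits
  -- are their directions.
  item-injective : ∀ {x y e f} → coordinate x e ≡ coordinate y f → bit x e ≡ bit y f → x ≡ y × e ≡ f
  item-injective {x} {y} {e} {f} ceq beq with x Fin.≟ y
  item-injective {x} {.x} {e} {f} ceq beq | yes refl with doubled? x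
  ... | yes _  = refl , beq
  ... | no ¬dx = refl , decidable-stable (e Fin.≟ f) λ e≢f → ¬dx (≡⇒doubled e f e≢f ceq)
  item-injective {x} {y} {e} {f} ceq beq | no x≢y with doubled? x | doubled? y
  ... | yes dx | _      = contradiction (doubled-alone {e = e} dx ceq) x≢y
  ... | no  _  | yes dy = contradiction (sym (doubled-alone {e = f} dy (sym ceq))) x≢y
  ... | no  _  | no  _  = contradiction beq (proj₂ (same-coordinate x≢y ceq))

  encode : Fin (a * 2) → Fin (d * 2)
  encode c = let x , e = remQuot {a} 2 c in combine (coordinate x e) (bit x e)

  -- An item is recovered from its coordinate and its bit, so `a * 2` items fit into `d * 2` places.
  encode-injective : Injective _≡_ _≡_ encode
  encode-injective {c} {c′} eq = trans (sym (combine-remQuot {a} 2 c))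
    (trans (uncurry (cong₂ combine) (uncurry item-injective (combine-injective _ _ _ _ eq)))
      (combine-remQuot {a} 2 c′))

  a≤d : a ≤ d
  a≤d = ℕ.*-cancelʳ-≤ a d 2 (injective⇒≤ encode-injective)

-- Subsets made of consecutive blocks

∣p++q∣≡∣p∣+∣q∣ : ∀ {m n} (p : Subset m) (q : Subset n) → ∣ p ++ q ∣ ≡ ∣ p ∣ + ∣ q ∣
∣p++q∣≡∣p∣+∣q∣ []          q = refl
∣p++q∣≡∣p∣+∣q∣ (true  ∷ p) q = cong suc (∣p++q∣≡∣p∣+∣q∣ p q)
∣p++q∣≡∣p∣+∣q∣ (false ∷ p) q = ∣p++q∣≡∣p∣+∣q∣ p q

∩-++ : ∀ {m n} (p p′ : Subset m) (q q′ : Subset n) → (p ++ q) ∩ (p′ ++ q′) ≡ (p ∩ p′) ++ (q ∩ q′)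
∩-++ []      []        q q′ = refl
∩-++ (_ ∷ p) (_ ∷ p′) q q′ = cong (_ ∷_) (∩-++ p p′ q q′)

⊥-++ : ∀ m n → ⊥ {m + n} ≡ ⊥ {m} ++ ⊥ {n}
⊥-++ zero    n = refl
⊥-++ (suc m) n = cong (false ∷_) (⊥-++ m n)

-- Width 1 gives the singletons of the rows, width `k′` the sets Q c of the columns.
block : ∀ {m} w → Fin m → Subset (m * w)
block {suc m} w zero    = ⊤ {w} ++ ⊥
block         w (suc c) = ⊥ {w} ++ block w c

∣block∣ : ∀ {m} w (c : Fin m) → ∣ block w c ∣ ≡ w
∣block∣ {suc m} w zero    = trans (∣p++q∣≡∣p∣+∣q∣ (⊤ {w}) ⊥)
  (trans (cong₂ _+_ (∣⊤∣≡n w) (∣⊥∣≡0 (m * w))) (ℕ.+-identityʳ w))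
∣block∣         w (suc c) = trans (∣p++q∣≡∣p∣+∣q∣ (⊥ {w}) (block w c)) (cong₂ _+_ (∣⊥∣≡0 w) (∣block∣ w c))

block≢⊥ : ∀ {m} w .{{_ : NonZero w}} (c : Fin m) → block w c ≢ ⊥
block≢⊥ {m} w c eq =
  ≢-nonZero⁻¹ w (trans (sym (∣block∣ w c)) (trans (cong ∣_∣ eq) (∣⊥∣≡0 (m * w))))

blocks-disjoint : ∀ {m} w {c c′ : Fin m} → c ≢ c′ → block w c ∩ block w c′ ≡ ⊥
blocks-disjoint w {zero}  {zero}   c≢c′ = contradiction refl c≢c′
blocks-disjoint {suc m} w {zero}  {suc c′} _ =
  trans (∩-++ (⊤ {w}) ⊥ ⊥ (block w c′))
    (trans (cong₂ _++_ (∩-zeroʳ ⊤) (∩-zeroˡ (block w c′))) (sym (⊥-++ w (m * w))))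
blocks-disjoint {suc m} w {suc c} {zero} _ =
  trans (∩-++ (⊥ {w}) ⊤ (block w c) ⊥)
    (trans (cong₂ _++_ (∩-zeroˡ ⊤) (∩-zeroʳ (block w c))) (sym (⊥-++ w (m * w))))
blocks-disjoint {suc m} w {suc c} {suc c′} c≢c′ =
  trans (∩-++ (⊥ {w}) ⊥ (block w c) (block w c′))
    (trans (cong₂ _++_ (∩-zeroˡ ⊥) (blocks-disjoint w (c≢c′ ∘ cong suc))) (sym (⊥-++ w (m * w))))

-- The grid of k-sets and its separated items

module Grid (a k′ : ℕ) .{{_ : NonZero k′}} where

  -- The ground set is kept in the form `a * 1 + 4 * k′`, the length of a row block followed by a
  -- column block.
  G : FiniteGraph
  G = Kn (suc k′) (a * 1 + 4 * k′)

  open FiniteGraph G using (Vertex; Adj)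
  open Existence using (index; vertex; vertex-index; natRep; IsNatRep; low; high; boxRep⇒rankRep)

  cell : Fin a → Fin 4 → Vertex
  cell x c = block 1 x ++ block k′ c ,
    trans (∣p++q∣≡∣p∣+∣q∣ (block 1 x) (block k′ c)) (cong₂ _+_ (∣block∣ 1 x) (∣block∣ k′ c))

  cell-∩ : ∀ x c y c′ → proj₁ (cell x c) ∩ proj₁ (cell y c′)
                       ≡ (block 1 x ∩ block 1 y) ++ (block k′ c ∩ block k′ c′)
  cell-∩ x c y c′ = ∩-++ (block 1 x) (block 1 y) (block k′ c) (block k′ c′)

  cells-adjacent : ∀ {x y c c′} → x ≢ y → c ≢ c′ → Adj (cell x c) (cell y c′)
  cells-adjacent {x} {y} {c} {c′} x≢y c≢c′ (z , z∈) = ∉⊥ (subst (z ∈_)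
    (trans (cell-∩ x c y c′)
      (trans (cong₂ _++_ (blocks-disjoint 1 x≢y) (blocks-disjoint k′ c≢c′)) (sym (⊥-++ (a * 1) (4 * k′)))))
    z∈)

  row-nonadjacent : ∀ x c c′ → ¬ Adj (cell x c) (cell x c′)
  row-nonadjacent x c c′ adj = block≢⊥ 1 x (trans (sym (∩-idem (block 1 x)))
    (++-injectiveˡ (block 1 x ∩ block 1 x) ⊥
      (trans (sym (cell-∩ x c x c′)) (trans (Empty-unique adj) (⊥-++ (a * 1) (4 * k′))))))

  -- Equal cells have equal column blocks; were the columns different, this block would be disjoint
  -- from itself, hence empty.
  cell-injectiveʳ : ∀ {x c c′} → cell x c ≡ cell x c′ → c ≡ c′
  cell-injectiveʳ {x} {c} {c′} eq = decidable-stable (c Fin.≟ c′) λ c≢c′ →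
    block≢⊥ k′ c (trans (sym (∩-idem (block k′ c)))
      (trans (cong (block k′ c ∩_) (++-injectiveʳ (block 1 x) (block 1 x) (cong proj₁ eq)))
        (blocks-disjoint k′ c≢c′)))

  column : Fin 2 → Fin 2 → Fin 4
  column = combine

  module _ {d} {l h : Fin d → Fin (Existence.N G) → ℕ} (isRep : IsNatRep G l h) where

    cellIndex : Fin a → Fin 2 → Fin 2 → Fin (Existence.N G)
    cellIndex x e o = index G (cell x (column e o))

    l′ h′ : Fin d → Fin a → Fin 2 → Fin 2 → ℕ
    l′ i x e o = l i (cellIndex x e o)
    h′ i x e o = h i (cellIndex x e o)

    vertex-cell : ∀ x e o → vertex G (cellIndex x e o) ≡ cell x (column e o)
    vertex-cell x e o = vertex-index G (cell x (column e o))

    cells-overlap : ∀ i {x y e f o t} → x ≢ y → ¬ (e ≡ f × o ≡ t) → l′ i x e o ≤ h′ i y f t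
    cells-overlap i {x} {y} {e} {f} {o} {t} x≢y ne =
      proj₁ (proj₁ (IsNatRep.rep isRep (cellIndex x e o) (cellIndex y f t)
                     λ eq → FiniteGraph.irrefl G u (subst (Adj u) (sym eq) adj)) adj i)
      where
      u : Vertex
      u = vertex G (cellIndex x e o)

      adj : Adj (vertex G (cellIndex x e o)) (vertex G (cellIndex y f t))
      adj = subst₂ Adj (sym (vertex-cell x e o)) (sym (vertex-cell y f t))
              (cells-adjacent x≢y λ eq → ne (combine-injective e o f t eq))

    Overlap : Fin d → Fin a → Fin 2 → Set
    Overlap i x e = l′ i x e 0F ≤ h′ i x e 1F × l′ i x e 1F ≤ h′ i x e 0F

    row-separated : ∀ x e → ¬ (∀ i → Overlap i x e)
    row-separated x e all = row-nonadjacent x (column e 0F) (column e 1F)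
      (subst₂ Adj (vertex-cell x e 0F) (vertex-cell x e 1F) (proj₂ (IsNatRep.rep isRep (cellIndex x e 0F) (cellIndex x e 1F) distinct) all))
      where
      distinct : vertex G (cellIndex x e 0F) ≢ vertex G (cellIndex x e 1F)
      distinct eq = contradiction
        (combine-injectiveʳ e 0F e 1F
          (cell-injectiveʳ {x} (trans (sym (vertex-cell x e 0F)) (trans eq (vertex-cell x e 1F)))))
        λ ()

    row-order : ∀ x e → ∃₂ λ i o → h′ i x e o < l′ i x e (opposite o)
    row-order x e
      with ¬∀⟶∃¬ d (λ i → Overlap i x e)
             (λ i → (l′ i x e 0F ℕ.≤? h′ i x e 1F) ×-dec (l′ i x e 1F ℕ.≤? h′ i x e 0F))
             (row-separated x e)
    ... | i , ¬both with l′ i x e 0F ℕ.≤? h′ i x e 1F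
    -- The direction names the place whose interval ends first, here 1F.
    ...   | no  l≰h = i , 1F , ℕ.≰⇒> l≰h
    ...   | yes l≤h = i , 0F , ℕ.≰⇒> λ l≤h′ → ¬both (l≤h , l≤h′)

    natRep⇒a≤d : a ≤ d
    natRep⇒a≤d = ItemCounting.a≤d l′ h′ row-order cells-overlap

  -- Real endpoints can be replaced by ranks only up to double negation, which suffices because
  -- `a ≤ d` is decidable.
  boxRep⇒a≤d : ∀ {d} → BoxRep G d → a ≤ d
  boxRep⇒a≤d {d} rep = decidable-stable (a ℕ.≤? d) λ a≰d →
    boxRep⇒rankRep G rep λ (_ , isRep) → a≰d (natRep⇒a≤d isRep)

box-lower : ∀ k′ n .{{_ : NonZero k′}} → n ≤ box (Kn (suc k′) n) + 4 * k′
box-lower k′ n with ℕ.≤-total (4 * k′) n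
... | inj₂ n≤4k′ = ℕ.≤-trans n≤4k′ (ℕ.m≤n+m (4 * k′) (box (Kn (suc k′) n)))
... | inj₁ 4k′≤n = begin
  n                               ≡⟨ ℕ.m∸n+n≡m 4k′≤n ⟨
  n ∸ 4 * k′ + 4 * k′             ≤⟨ ℕ.+-monoˡ-≤ (4 * k′) (Grid.boxRep⇒a≤d (n ∸ 4 * k′) k′ rep) ⟩
  box (Kn (suc k′) n) + 4 * k′    ∎
  where
  open ≤-Reasoning
  n≡ : n ≡ (n ∸ 4 * k′) * 1 + 4 * k′
  n≡ = sym (trans (cong (_+ 4 * k′) (ℕ.*-identityʳ (n ∸ 4 * k′))) (ℕ.m∸n+n≡m 4k′≤n))
  rep : BoxRep (Kn (suc k′) ((n ∸ 4 * k′) * 1 + 4 * k′)) (box (Kn (suc k′) n))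
  rep = subst (λ m → BoxRep (Kn (suc k′) m) (box (Kn (suc k′) n))) n≡ (proj₁ (box-isBoxicity (Kn (suc k′) n)))

-- From natural numbers to the rational bound

n/1-c/2≤b/1 : ∀ n b c → + 2 ℤ.* n ℤ.≤ + 2 ℤ.* b ℤ.+ c → n / 1 ℚ.- c / 2 ℚ.≤ b / 1
n/1-c/2≤b/1 n b c 2n≤2b+c = ℚ.toℚᵘ-cancel-≤ (begin
  toℚᵘ (n / 1 ℚ.- c / 2)              ≃⟨ ℚ.toℚᵘ-homo-+ (n / 1) (ℚ.- (c / 2)) ⟩
  toℚᵘ (n / 1) ℚᵘ.+ toℚᵘ (ℚ.- (c / 2)) ≃⟨ ℚᵘ.+-congʳ (toℚᵘ (n / 1)) (ℚ.toℚᵘ-homo‿- (c / 2)) ⟩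
  toℚᵘ (n / 1) ℚᵘ.- toℚᵘ (c / 2)      ≃⟨ ℚᵘ.+-cong (ℚ.toℚᵘ-fromℚᵘ (mkℚᵘ n 0)) (ℚᵘ.-‿cong (ℚ.toℚᵘ-fromℚᵘ (mkℚᵘ c 1))) ⟩
  -- The unnormalised fractions keep the denominators 1 and 2, so cross-multiplying leaves an
  -- inequality of integers.
  mkℚᵘ n 0 ℚᵘ.- mkℚᵘ c 1              ≤⟨ ℚᵘ.*≤* crossed ⟩
  mkℚᵘ b 0                            ≃⟨ ℚ.toℚᵘ-fromℚᵘ (mkℚᵘ b 0) ⟨
  toℚᵘ (b / 1)                        ∎)
  where
  open ℚᵘ.≤-Reasoning
  lhs : ∀ n c → (n ℤ.* + 2 ℤ.+ ℤ.- c ℤ.* + 1) ℤ.* + 1 ≡ + 2 ℤ.* n ℤ.- c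
  lhs = solve-∀
  rhs : ∀ b c → + 2 ℤ.* b ℤ.+ c ℤ.- c ≡ b ℤ.* + 2
  rhs = solve-∀
  crossed : (n ℤ.* + 2 ℤ.+ ℤ.- c ℤ.* + 1) ℤ.* + 1 ℤ.≤ b ℤ.* + 2
  crossed = subst₂ ℤ._≤_ (sym (lhs n c)) (rhs b c) (ℤ.+-monoˡ-≤ (ℤ.- c) 2n≤2b+c)

-- With k = j + 2 the difference 13k² − 11k + 16 − 8(k−1) is 13j² + 33j + 38.
8k-8≤13k²-11k+16 : ∀ j → + (8 * suc j) ℤ.≤ + 13 ℤ.* + (suc (suc j) ^ 2) ℤ.- + 11 ℤ.* + suc (suc j) ℤ.+ + 16
8k-8≤13k²-11k+16 j = subst (+ (8 * suc j) ℤ.≤_) eq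
  (ℤ.i≤i+j (+ (8 * suc j)) (+ (13 * (j * j) + 33 * j + 38)))
  where
  -- The trailing factor 1 matches the unfolding of `suc (suc j) ^ 2`.
  identity : ∀ x → + 8 ℤ.* (+ 1 ℤ.+ x) ℤ.+ (+ 13 ℤ.* (x ℤ.* x) ℤ.+ + 33 ℤ.* x ℤ.+ + 38)
    ≡ + 13 ℤ.* ((+ 2 ℤ.+ x) ℤ.* ((+ 2 ℤ.+ x) ℤ.* + 1)) ℤ.- + 11 ℤ.* (+ 2 ℤ.+ x) ℤ.+ + 16
  identity = solve-∀
  eq : + (8 * suc j) ℤ.+ + (13 * (j * j) + 33 * j + 38)
    ≡ + 13 ℤ.* + (suc (suc j) ^ 2) ℤ.- + 11 ℤ.* + suc (suc j) ℤ.+ + 16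
  eq = trans (cong₂ ℤ._+_ (ℤ.pos-* 8 (suc j))
               (cong (ℤ._+ + 38) (cong₂ ℤ._+_ (trans (ℤ.pos-* 13 (j * j)) (cong (+ 13 ℤ.*_) (ℤ.pos-* j j))) (ℤ.pos-* 33 j))))
         (trans (identity (+ j))
           (cong (λ s → + 13 ℤ.* s ℤ.- + 11 ℤ.* + suc (suc j) ℤ.+ + 16)
             (trans (cong (+ suc (suc j) ℤ.*_) (sym (ℤ.pos-* (suc (suc j)) 1)))
               (sym (ℤ.pos-* (suc (suc j)) (suc (suc j) * 1))))))

theorem1p1 : (k n : ℕ) .{{_ : NonZero k}} .{{_ : NonZero n}} → n ≥ 2 * k + 1 →
    box (Kn k n) ≤ n ∸ 2
    × (k ≥ 2 → n ≥ 2 * k ^ 3 ∸ 2 * k ^ 2 + 1 →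
    + box (Kn k n) / 1 ℚ.≥ + n / 1 ℚ.- (+ 13 ℤ.* + (k ^ 2) ℤ.- + 11 ℤ.* + k ℤ.+ + 16) / 2)
theorem1p1 k n n≥2k+1 = box-upper k n 2≤n , λ k≥2 _ → lower k k≥2
  where
  2≤n : 2 ≤ n
  2≤n = ℕ.≤-trans (ℕ.≤-trans (ℕ.m≤m*n 2 k) (ℕ.m≤m+n (2 * k) 1)) n≥2k+1

  lower : ∀ k .{{_ : NonZero k}} → k ≥ 2 →
    + box (Kn k n) / 1 ℚ.≥ + n / 1 ℚ.- (+ 13 ℤ.* + (k ^ 2) ℤ.- + 11 ℤ.* + k ℤ.+ + 16) / 2
  lower (suc zero)    (s≤s ())
  lower (suc (suc j)) _ = n/1-c/2≤b/1 (+ n) (+ b) c (begin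
    -- Here k = j + 2, so `box-lower` gives n ≤ b + 4(k-1); doubling clears the denominator of c /
    -- 2.
    + 2 ℤ.* + n                     ≡⟨ ℤ.pos-* 2 n ⟨
    + (2 * n)                       ≤⟨ ℤ.+≤+ (ℕ.*-monoʳ-≤ 2 (box-lower (suc j) n)) ⟩
    + (2 * (b + 4 * suc j))         ≡⟨ cong +_ (ℕ.*-distribˡ-+ 2 b (4 * suc j)) ⟩
    + (2 * b) ℤ.+ + (2 * (4 * suc j)) ≡⟨ cong₂ ℤ._+_ (ℤ.pos-* 2 b) (cong +_ (sym (ℕ.*-assoc 2 4 (suc j)))) ⟩
    + 2 ℤ.* + b ℤ.+ + (8 * suc j)   ≤⟨ ℤ.+-monoʳ-≤ (+ 2 ℤ.* + b) (8k-8≤13k²-11k+16 j) ⟩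
    + 2 ℤ.* + b ℤ.+ c               ∎)
    where
    open ℤ.≤-Reasoning
    b = box (Kn (suc (suc j)) n)
    c = + 13 ℤ.* + (suc (suc j) ^ 2) ℤ.- + 11 ℤ.* + suc (suc j) ℤ.+ + 16
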